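{- Let $\mathcal{A}$ be an alphabet and let $x \in \mathcal{A}^{\mathbb{Z}}$ be a bi-infinite word. The following are equivalent: (1) $x$ is eventually dendric, with threshold $N$; (2) $x$ is eventually acyclic, with threshold $M$; (2') $x$ is eventually neutral, with threshold $M'$; (3) $x$ is eventually weak or neutral, with threshold $K$. Moreover (when these equivalent properties hold, and denoting by $N, M, M', K$ the respective thresholds), $K \leq M \leq N$ and $K \leq M' \leq N$.
   Context: An alphabet is a finite set of letters (of size at least 2). For $x \in \mathcal{A}^{\mathbb{Z}}$, $\mathcal{L}(x)$ is the set of finite factors of $x$ (including the empty word), and $\mathcal{L}_{\geq n}(x)$ is the set of factors of length at least $n$. For $w \in \mathcal{L}(x)$ define $E^-_x(w) = \{a \in \mathcal{A} \mid aw \in \mathcal{L}(x)\}$, $E^+_x(w) = \{b \in \mathcal{A} \mid wb \in \mathcal{L}(x)\}$, $E_x(w) = \{(a,b) \in \mathcal{A}\times\mathcal{A} \mid awb \in \mathcal{L}(x)\}$, and the multiplicity $m_x(w) = \# E_x(w) - \# E^-_x(w) - \# E^+_x(w) + 1$. The word $w$ is neutral if $m_x(w) = 0$, and weak if $m_x(w) < 0$. The extension graph of $w$ in $x$ is the undirected bipartite graph whose vertex set is the disjoint union of $E^-_x(w)$ and $E^+_x(w)$, with an edge between $a \in E^-_x(w)$ and $b \in E^+_x(w)$ iff $(a,b) \in E_x(w)$. The word $w$ is dendric (resp., acyclic) if its extension graph is a tree (resp., has no cycle). For a property $P$ among "neutral", "weak or neutral", "dendric", "acyclic", the bi-infinite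 word $x$ is eventually $P$ if there exists $n \geq 0$ such that all words of $\mathcal{L}_{\geq n}(x)$ satisfy $P$; the smallest such $n$ is called the threshold. -}

module Defs where

open import Axiom.ExcludedMiddle using (ExcludedMiddle)
open import Data.Fin.Base using (Fin; toℕ)
open import Data.Integer.Base as ℤ using (ℤ; +_; 0ℤ; 1ℤ)
open import Data.List.Base using (List; _∷_; _∷ʳ_; length; lookup; map; filter; allFin; cartesianProduct)
open import Data.List.Relation.Unary.Linked using (Linked)
open import Data.List.Relation.Unary.Unique.Propositional using (Unique)
open import Data.Nat.Base using (ℕ; _≤_)
open import Data.Product.Base using (∃; ∃-syntax; _×_; _,_)
open import Data.Sum.Base using (_⊎_; inj₁; inj₂)
open import Function.Bundles using (_↔_; Inverse)
open import Level using (0ℓ)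
open import Relation.Binary.Construct.Closure.ReflexiveTransitive using (Star)
open import Relation.Binary.Core using (Rel)
open import Relation.Binary.PropositionalEquality.Core using (_≡_)
open import Relation.Nullary.Negation.Core using (¬_)
open import Relation.Unary using (Pred)

record Alphabet : Set₁ where
  field
    Letter      : Set
    size        : ℕ
    2≤size      : 2 ≤ size
    enumeration : Fin size ↔ Letter

  letters : List Letter
  letters = map (Inverse.to enumeration) (allFin size)

open Alphabet public using (Letter; letters)

Word : Set → Set
Word A = List A

BiInfiniteWord : Set → Set
BiInfiniteWord A = ℤ → A

-- Simple undirected graphs whose vertex set is a subset of an ambient type.
-- Vertices are compared in the ambient type, so that different proofs of
-- IsVertex v do not give different vertices.
record Graph : Set₁ where
  field
    Ambient    : Set
    IsVertex   : Pred Ambient 0ℓ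
    Adj        : Rel Ambient 0ℓ
    adj-vertex : ∀ {u v} → Adj u v → IsVertex u
    adj-sym    : ∀ {u v} → Adj u v → Adj v u
    adj-irrefl : ∀ {v} → ¬ Adj v v

module _ (G : Graph) where
  open Graph G

  Connected : Set
  Connected = ∃ IsVertex × (∀ {u v} → IsVertex u → IsVertex v → Star Adj u v)

  -- A cycle is a list v ∷ vs of at least three distinct vertices such that
  -- consecutive ones are adjacent and the last one is adjacent to v.
  HasCycle : Set
  HasCycle = ∃[ v ] ∃[ vs ]
    3 ≤ length (v ∷ vs) × Unique (v ∷ vs) × Linked Adj ((v ∷ vs) ∷ʳ v)

  NoCycle : Set
  NoCycle = ¬ HasCycle

  IsTree : Set
  IsTree = Connected × NoCycle

module _ {A : Set} (x : BiInfiniteWord A) where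

  𝓛 : Pred (Word A) 0ℓ
  𝓛 w = ∃[ i ] ((j : Fin (length w)) → x (i ℤ.+ + toℕ j) ≡ lookup w j)

  E⁻ : Word A → Pred A 0ℓ
  E⁻ w a = 𝓛 (a ∷ w)

  E⁺ : Word A → Pred A 0ℓ
  E⁺ w b = 𝓛 (w ∷ʳ b)

  E : Word A → Pred (A × A) 0ℓ
  E w (a , b) = 𝓛 (a ∷ (w ∷ʳ b))

  -- The vertex set is the disjoint union of E⁻ w (inj₁) and E⁺ w (inj₂).
  data ExtensionVertex (w : Word A) : Pred (A ⊎ A) 0ℓ where
    left  : ∀ {a} → E⁻ w a → ExtensionVertex w (inj₁ a)
    right : ∀ {b} → E⁺ w b → ExtensionVertex w (inj₂ b)

  data ExtensionEdge (w : Word A) : Rel (A ⊎ A) 0ℓ where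
    left-right : ∀ {a b} → E⁻ w a → E⁺ w b → E w (a , b) →
                 ExtensionEdge w (inj₁ a) (inj₂ b)
    right-left : ∀ {a b} → E⁻ w a → E⁺ w b → E w (a , b) →
                 ExtensionEdge w (inj₂ b) (inj₁ a)

  extensionGraph : Word A → Graph
  extensionGraph w = record
    { Ambient    = A ⊎ A
    ; IsVertex   = ExtensionVertex w
    ; Adj        = ExtensionEdge w
    ; adj-vertex = λ { (left-right a∈ _ _) → left a∈ ; (right-left _ b∈ _) → right b∈ }
    ; adj-sym    = λ { (left-right a∈ b∈ e) → right-left a∈ b∈ e
                     ; (right-left a∈ b∈ e) → left-right a∈ b∈ e }
    ; adj-irrefl = λ ()
    }

  Dendric : Pred (Word A) 0ℓ
  Dendric w = IsTree (extensionGraph w)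

  Acyclic : Pred (Word A) 0ℓ
  Acyclic w = NoCycle (extensionGraph w)

  From : Pred (Word A) 0ℓ → Pred ℕ 0ℓ
  From P n = ∀ w → 𝓛 w → n ≤ length w → P w

  Eventually : Pred (Word A) 0ℓ → Set
  Eventually P = ∃[ n ] From P n

  IsThreshold : Pred (Word A) 0ℓ → Pred ℕ 0ℓ
  IsThreshold P n = From P n × (∀ m → From P m → n ≤ m)

-- Membership in 𝓛 x is not decidable for an arbitrary x, so the cardinalities
-- of the extension sets are defined from excluded middle.
module _ (em : ExcludedMiddle 0ℓ) (𝒜 : Alphabet) (x : BiInfiniteWord (Letter 𝒜)) where

  #E⁻ : Word (Letter 𝒜) → ℕ
  #E⁻ w = length (filter (λ a → em {E⁻ x w a}) (letters 𝒜))

  #E⁺ : Word (Letter 𝒜) → ℕ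
  #E⁺ w = length (filter (λ b → em {E⁺ x w b}) (letters 𝒜))

  #E : Word (Letter 𝒜) → ℕ
  #E w = length (filter (λ ab → em {E x w ab}) (cartesianProduct (letters 𝒜) (letters 𝒜)))

  multiplicity : Word (Letter 𝒜) → ℤ
  multiplicity w = + #E w ℤ.- + #E⁻ w ℤ.- + #E⁺ w ℤ.+ 1ℤ

  Neutral : Pred (Word (Letter 𝒜)) 0ℓ
  Neutral w = multiplicity w ≡ 0ℤ

  Weak : Pred (Word (Letter 𝒜)) 0ℓ
  Weak w = multiplicity w ℤ.< 0ℤ

  WeakOrNeutral : Pred (Word (Letter 𝒜)) 0ℓ
  WeakOrNeutral w = Weak w ⊎ Neutral w

{-# OPTIONS --safe #-}

-- Put f(w) = #E⁺(w) − 1.  For w in the language, m(w) ≤ 0 says exactly that the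
-- sum of f(aw) over the left extensions aw of w is at most f(w).  Along repeated
-- left extension a natural number can split or drop only finitely often, so every
-- long enough w has a left extension aw with f(aw) = f(w), hence with
-- E⁺(aw) = E⁺(w), and f vanishes on all the other left extensions.  In the
-- extension graph of such a w the vertex a is adjacent to every right vertex and
-- every other left vertex is a leaf: the graph is a tree.  The remaining
-- implications hold word by word, by comparing the numbers of vertices and edges
-- of trees and of forests.

module Submission where

open import Defs
open import Axiom.ExcludedMiddle using (ExcludedMiddle)
open import Data.Fin.Base using (Fin; zero; suc; toℕ)
open import Data.Integer.Base as ℤ using (ℤ; +_; 0ℤ; 1ℤ)
import Data.Integer.Properties as ℤ
open import Data.Integer.Tactic.RingSolver using (solve-∀)
open import Data.List.Base using (List; []; _∷_; _∷ʳ_; _++_; _ʳ++_; length; lookup; map; filter; reverse; cartesianProduct)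
open import Data.List.Membership.Propositional using (_∈_; _∉_; lose)
open import Data.List.Membership.Propositional.Properties using (∈-map⁺; ∈-map⁻; ∈-++⁺ˡ; ∈-++⁺ʳ; ∈-++⁻; ∈-filter⁺; ∈-filter⁻; ∈-allFin; ∈-cartesianProduct⁺)
open import Data.List.Properties using (filter-++; filter-all; filter-none; filter-accept; filter-reject; filter-some; length-++; length-map; length-reverse; reverse-involutive)
open import Data.List.Relation.Binary.Equality.Propositional using (≋⇒≡)
open import Data.List.Relation.Binary.Sublist.Propositional using (_⊆_; ⊆-refl)
open import Data.List.Relation.Binary.Sublist.Propositional.Properties using (length-mono-≤; to-≋) renaming (filter⁺ to ⊆-filter⁺)
open import Data.List.Relation.Unary.All as All using (All; []; _∷_)
open import Data.List.Relation.Unary.All.Properties using (¬Any⇒All¬)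
open import Data.List.Relation.Unary.AllPairs as AllPairs using (AllPairs; []; _∷_)
import Data.List.Relation.Unary.AllPairs.Properties as AllPairs
open import Data.List.Relation.Unary.Any using (here; there)
open import Data.List.Relation.Unary.Linked as Linked using (Linked; [-]; _∷_)
open import Data.List.Relation.Unary.Unique.Propositional using (Unique)
import Data.List.Relation.Unary.Unique.Propositional.Properties as Unique
open import Data.Nat.Base using (ℕ; zero; suc; pred; _+_; _≤_; _<_; z≤n; s≤s; s≤s⁻¹; >-nonZero)
open import Data.Nat.Induction using (<-rec)
open import Data.Nat.ListAction using (sum)
open import Data.Nat.Properties
open import Data.Product.Base using (∃; ∃-syntax; _×_; _,_; proj₁; proj₂; swap)
open import Data.Sum.Base as Sum using (_⊎_; inj₁; inj₂)
open import Data.Sum.Properties using (inj₁-injective; inj₂-injective)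
open import Data.Unit.Base using (⊤; tt)
open import Function.Base using (_∘_; id)
open import Function.Bundles using (_⇔_; mk⇔; Inverse; Equivalence)
open import Level using (0ℓ)
open import Relation.Binary.Construct.Closure.ReflexiveTransitive as Star using (Star; ε; _◅_; _◅◅_)
open import Relation.Binary.Core using (Rel)
open import Relation.Binary.Definitions using (DecidableEquality)
open import Relation.Binary.PropositionalEquality using (_≡_; _≢_; refl; sym; trans; cong; cong₂; subst; subst₂; module ≡-Reasoning)
open import Relation.Nullary.Decidable using (Dec; yes; no; ¬?; decidable-stable)
open import Relation.Nullary.Negation using (¬_; contradiction)
open import Relation.Unary using (Pred; Decidable)

private variable
  A B : Set

-- Sums and cardinalities over lists

∈⇒≤sum : (g : A → ℕ) {a : A} {xs : List A} → a ∈ xs → g a ≤ sum (map g xs)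
∈⇒≤sum g (here refl) = m≤m+n _ _
∈⇒≤sum g (there a∈)  = m≤n⇒m≤o+n _ (∈⇒≤sum g a∈)

∈-≢⇒+≤sum : (g : A → ℕ) {a b : A} {xs : List A} → a ∈ xs → b ∈ xs → a ≢ b →
            g a + g b ≤ sum (map g xs)
∈-≢⇒+≤sum g (here refl) (here refl) a≢b = contradiction refl a≢b
∈-≢⇒+≤sum g (here refl) (there b∈)  a≢b = +-monoʳ-≤ _ (∈⇒≤sum g b∈)
∈-≢⇒+≤sum g {a} {b} (there a∈) (here refl) a≢b =
  ≤-trans (≤-reflexive (+-comm (g a) (g b))) (+-monoʳ-≤ _ (∈⇒≤sum g a∈))
∈-≢⇒+≤sum g (there a∈)  (there b∈)  a≢b = m≤n⇒m≤o+n _ (∈-≢⇒+≤sum g a∈ b∈ a≢b)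

length≤1⇒≡ : ∀ {a b : A} {xs} → length xs ≤ 1 → a ∈ xs → b ∈ xs → a ≡ b
length≤1⇒≡ _        (here refl) (here refl)         = refl
length≤1⇒≡ (s≤s ()) (here _)    (there (here _))
length≤1⇒≡ (s≤s ()) (here _)    (there (there _))
length≤1⇒≡ (s≤s ()) (there (here _))  _
length≤1⇒≡ (s≤s ()) (there (there _)) _

module _ {P Q : Pred A 0ℓ} (P? : Decidable P) (Q? : Decidable Q) (P⊆Q : ∀ {a} → P a → Q a) where

  private
    filter-⊆ : (xs : List A) → filter P? xs ⊆ filter Q? xs
    filter-⊆ xs = ⊆-filter⁺ P? Q? (λ { refl → P⊆Q }) (⊆-refl {x = xs})

  length-filter-mono : ∀ xs → length (filter P? xs) ≤ length (filter Q? xs)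
  length-filter-mono xs = length-mono-≤ (filter-⊆ xs)

  -- The elements satisfying `P` form a sublist of those satisfying `Q`, and a sublist of full
  -- length is the whole list.
  length-filter-≡⇒⊇ : ∀ {xs a} → length (filter P? xs) ≡ length (filter Q? xs) →
                      a ∈ xs → Q a → P a
  length-filter-≡⇒⊇ {xs} eq a∈ q =
    proj₂ (∈-filter⁻ P? {xs = xs} (subst (_ ∈_) (sym (≋⇒≡ (to-≋ eq (filter-⊆ xs)))) (∈-filter⁺ Q? a∈ q)))

length-filter-map : {P : Pred B 0ℓ} (P? : Decidable P) (f : A → B) (xs : List A) →
                    length (filter P? (map f xs)) ≡ length (filter (P? ∘ f) xs)
length-filter-map P? f [] = refl
length-filter-map P? f (a ∷ xs) with P? (f a)
... | yes _ = cong suc (length-filter-map P? f xs)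
... | no  _ = length-filter-map P? f xs

length-filter-cartesianProduct : {P : Pred (A × B) 0ℓ} (P? : Decidable P) (xs : List A) (ys : List B) →
  length (filter P? (cartesianProduct xs ys)) ≡
  sum (map (λ a → length (filter (λ b → P? (a , b)) ys)) xs)
length-filter-cartesianProduct P? []       ys = refl
length-filter-cartesianProduct P? (a ∷ xs) ys = begin
  length (filter P? (row ++ rest))                  ≡⟨ cong length (filter-++ P? row rest) ⟩
  length (filter P? row ++ filter P? rest)          ≡⟨ length-++ (filter P? row) ⟩
  length (filter P? row) + length (filter P? rest)  ≡⟨ cong₂ _+_ (length-filter-map P? (a ,_) ys)
                                                                 (length-filter-cartesianProduct P? xs ys) ⟩
  _                                                 ∎
  where
  open ≡-Reasoning
  row  = map (a ,_) ys
  rest = cartesianProduct xs ys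

-- An entry with `P` splits as one plus its predecessor, and the ones add up to the length. All
-- other entries vanish, and so do their truncated predecessors.
sum-pred : {P : Pred A 0ℓ} (P? : Decidable P) (g : A → ℕ) →
           (∀ a → P a → 0 < g a) → (∀ a → ¬ P a → g a ≡ 0) → ∀ xs →
           sum (map g xs) ≡ length (filter P? xs) + sum (map (pred ∘ g) xs)
sum-pred P? g pos zer [] = refl
sum-pred P? g pos zer (a ∷ xs) with P? a
... | no ¬p rewrite zer a ¬p = sum-pred P? g pos zer xs
... | yes p with g a | pos a p
...   | suc k | _ = cong suc (begin
  k + sum (map g xs)    ≡⟨ cong (_+_ k) (sum-pred P? g pos zer xs) ⟩
  k + (l + s)           ≡⟨ +-assoc k l s ⟨
  (k + l) + s           ≡⟨ cong (_+ s) (+-comm k l) ⟩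
  (l + k) + s           ≡⟨ +-assoc l k s ⟩
  l + (k + s)           ∎)
  where
  open ≡-Reasoning
  l = length (filter P? xs)
  s = sum (map (pred ∘ g) xs)

module _ (_≟_ : DecidableEquality A) where

  delete : A → List A → List A
  delete a = filter (λ b → ¬? (b ≟ a))

  length-delete : ∀ {a xs} → Unique xs → a ∈ xs → length xs ≡ suc (length (delete a xs))
  length-delete {a} {_ ∷ xs} (a∉ ∷ _) (here refl) = cong suc (sym (cong length (begin
    delete a (a ∷ xs)  ≡⟨ filter-reject (λ b → ¬? (b ≟ a)) (λ a≢a → a≢a refl) ⟩
    delete a xs        ≡⟨ filter-all (λ b → ¬? (b ≟ a)) (All.map (_∘ sym) a∉) ⟩
    xs                 ∎)))
    where open ≡-Reasoning
  length-delete {a} {b ∷ xs} (b∉ ∷ u) (there a∈) = cong suc (trans (length-delete u a∈)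
    (cong length (sym (filter-accept (λ c → ¬? (c ≟ a)) {b} (All.lookup b∉ a∈)))))

-- Edge counts of finite graphs

Link : List (A × A) → Rel A 0ℓ
Link es u v = (u , v) ∈ es ⊎ (v , u) ∈ es

-- Acyclicity in a form suited to induction on the edge list: no edge has its ends already joined by
-- the edges after it.
Forest : List (A × A) → Set
Forest []             = ⊤
Forest ((u , v) ∷ es) = ¬ Star (Link es) u v × Forest es

module _ {V : Set} (_≟_ : DecidableEquality V) where

  private
    merge : V → V → V → V
    merge s t r with r ≟ t
    ... | yes _ = s
    ... | no  _ = r

    merge-≡ : ∀ {s t r} → r ≡ t → merge s t r ≡ s
    merge-≡ {t = t} {r} r≡t with r ≟ t
    ... | yes _  = refl
    ... | no r≢t = contradiction r≡t r≢t

    merge-≢ : ∀ {s t r} → r ≢ t → merge s t r ≡ r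
    merge-≢ {t = t} {r} r≢t with r ≟ t
    ... | yes r≡t = contradiction r≡t r≢t
    ... | no _    = refl

  -- By `rep-edge` and `rep-joined`, two vertices share a representative exactly when edges join
  -- them. `count` is only an inequality because an edge inside a component merges nothing; `Forest`
  -- excludes such edges.
  record Components (vs : List V) (es : List (V × V)) : Set where
    field
      rep         : V → V
      reps        : List V
      rep-∈       : ∀ {v} → v ∈ vs → rep v ∈ reps
      reps-unique : Unique reps
      reps-⊆      : ∀ {r} → r ∈ reps → r ∈ vs
      rep-fixed   : ∀ {r} → r ∈ reps → rep r ≡ r
      rep-edge    : ∀ {u v} → (u , v) ∈ es → rep u ≡ rep v
      rep-joined  : ∀ v → Star (Link es) v (rep v)
      count       : length vs ≤ length es + length reps
      forestCount : Forest es → length vs ≡ length es + length reps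

    rep-path : ∀ {u v} → Star (Link es) u v → rep u ≡ rep v
    rep-path ε                 = refl
    rep-path (inj₁ uv∈ ◅ path) = trans (rep-edge uv∈) (rep-path path)
    rep-path (inj₂ vu∈ ◅ path) = trans (sym (rep-edge vu∈)) (rep-path path)

  -- Union–find: edges are added one by one, and each either merges two
  -- components or closes a cycle.
  components : ∀ {vs} → Unique vs → ∀ es → All (λ (u , v) → u ∈ vs × v ∈ vs) es → Components vs es
  components {vs} unique [] [] = record
    { rep         = id
    ; reps        = vs
    ; rep-∈       = id
    ; reps-unique = unique
    ; reps-⊆      = id
    ; rep-fixed   = λ _ → refl
    ; rep-edge    = λ ()
    ; rep-joined  = λ _ → ε
    ; count       = ≤-refl
    ; forestCount = λ _ → refl
    }
  components {vs} unique ((u , v) ∷ es) ((u∈ , v∈) ∷ es∈) = add (rep u ≟ rep v)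
    where
    open Components (components unique es es∈)

    weaken : ∀ {s t} → Star (Link es) s t → Star (Link ((u , v) ∷ es)) s t
    weaken = Star.map (Sum.map there there)

    add : Dec (rep u ≡ rep v) → Components vs ((u , v) ∷ es)
    add (yes eq) = record
      { rep         = rep
      ; reps        = reps
      ; rep-∈       = rep-∈
      ; reps-unique = reps-unique
      ; reps-⊆      = reps-⊆
      ; rep-fixed   = rep-fixed
      ; rep-edge    = λ { (here refl) → eq ; (there e∈) → rep-edge e∈ }
      ; rep-joined  = weaken ∘ rep-joined
      ; count       = m≤n⇒m≤1+n count
      ; forestCount = λ (¬joined , _) → contradiction
          (rep-joined u ◅◅ subst (λ r → Star (Link es) r v) (sym eq) (Star.reverse Sum.swap (rep-joined v)))
          ¬joined
      }
    add (no neq) = record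
      { rep         = rep′
      ; reps        = reps′
      ; rep-∈       = rep′-∈
      ; reps-unique = Unique.filter⁺ _ reps-unique
      ; reps-⊆      = reps-⊆ ∘ proj₁ ∘ ∈-filter⁻ _
      ; rep-fixed   = λ {r} r∈ → let r∈reps , r≢ = ∈-filter⁻ _ r∈ in
          trans (cong (merge (rep u) (rep v)) (rep-fixed r∈reps)) (merge-≢ r≢)
      ; rep-edge    = λ { (here refl) → trans (merge-≢ neq) (sym (merge-≡ refl))
                        ; (there e∈)  → cong (merge (rep u) (rep v)) (rep-edge e∈) }
      ; rep-joined  = rep′-joined
      ; count       = ≤-trans count (≤-reflexive shift)
      ; forestCount = λ (_ , forest) → trans (forestCount forest) shift
      }
      where
      rep′ : V → V
      rep′ = merge (rep u) (rep v) ∘ rep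

      reps′ : List V
      reps′ = delete _≟_ (rep v) reps

      shift : length es + length reps ≡ suc (length es + length reps′)
      shift = trans (cong (_+_ (length es)) (length-delete _≟_ reps-unique (rep-∈ v∈))) (+-suc _ _)

      rep′-∈ : ∀ {z} → z ∈ vs → rep′ z ∈ reps′
      rep′-∈ {z} z∈ with rep z ≟ rep v
      ... | yes _  = ∈-filter⁺ _ (rep-∈ u∈) neq
      ... | no neq = ∈-filter⁺ _ (rep-∈ z∈) neq

      rep′-joined : ∀ z → Star (Link ((u , v) ∷ es)) z (rep′ z)
      rep′-joined z with rep z ≟ rep v
      ... | no _   = weaken (rep-joined z)
      -- The path runs from `z` to `rep v`, back to `v`, across the new edge against its orientation
      -- to `u`, and on to `rep u`.
      ... | yes eq =
        weaken (subst (Star (Link es) z) eq (rep-joined z) ◅◅ Star.reverse Sum.swap (rep-joined v))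
        ◅◅ (inj₂ (here refl) ◅ weaken (rep-joined u))

-- The list index holds the vertices after the start, so that `u ∷ ps` has the shape of the vertex
-- list in `HasCycle`.
data SimplePath (R : Rel A 0ℓ) : A → List A → A → Set where
  done : ∀ {u} → SimplePath R u [] u
  step : ∀ {u v w ps} → R u w → u ∉ w ∷ ps → SimplePath R w ps v → SimplePath R u (w ∷ ps) v

module _ {R : Rel A 0ℓ} where

  simplePath-suffix : ∀ {u v w ps} → SimplePath R w ps v → u ∈ w ∷ ps → ∃[ qs ] SimplePath R u qs v
  simplePath-suffix path           (here refl) = _ , path
  simplePath-suffix (step _ _ path) (there u∈) = simplePath-suffix path u∈

  -- Loop erasure: if the new start already lies on the simple path obtained for the rest, only the
  -- part from there on is kept.
  star⇒simplePath : (∀ (u : A) vs → Dec (u ∈ vs)) → ∀ {u v} → Star R u v → ∃[ ps ] SimplePath R u ps v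
  star⇒simplePath _∈?_ ε = [] , done
  star⇒simplePath _∈?_ {u} (_◅_ {j = w} r rs) with star⇒simplePath _∈?_ rs
  ... | ps , path with u ∈? (w ∷ ps)
  ...   | yes u∈ = simplePath-suffix path u∈
  ...   | no  u∉ = w ∷ ps , step r u∉ path

  simplePath⇒unique : ∀ {u v ps} → SimplePath R u ps v → Unique (u ∷ ps)
  simplePath⇒unique done             = [] ∷ []
  simplePath⇒unique (step _ u∉ path) = ¬Any⇒All¬ _ u∉ ∷ simplePath⇒unique path

  simplePath⇒linked : ∀ {u v t ps} → SimplePath R u ps v → R v t → Linked R ((u ∷ ps) ∷ʳ t)
  simplePath⇒linked done            r = r ∷ [-]
  simplePath⇒linked (step q _ path) r = q ∷ simplePath⇒linked path r

-- Each undirected edge is listed once, in one of its two orientations. `edges-distinct` rules out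
-- repetition in either orientation, so `length edges` is the true number of edges.
record FiniteGraph (G : Graph) : Set where
  open Graph G
  field
    vertices        : List Ambient
    vertices-unique : Unique vertices
    vertex⇔         : ∀ {v} → IsVertex v ⇔ v ∈ vertices
    edges           : List (Ambient × Ambient)
    edges-distinct  : AllPairs (λ e e′ → e ≢ e′ × e ≢ swap e′) edges
    edge⇒adj        : ∀ {u v} → (u , v) ∈ edges → Adj u v
    adj⇒link        : ∀ {u v} → Adj u v → Link edges u v

module _ (em : ExcludedMiddle 0ℓ) {G : Graph} (fin : FiniteGraph G) where
  open Graph G
  open FiniteGraph fin

  private
    spanning : Components (λ _ _ → em) vertices edges
    spanning = components _ vertices-unique edges (All.tabulate λ e∈ →
      Equivalence.to vertex⇔ (adj-vertex (edge⇒adj e∈)) ,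
      Equivalence.to vertex⇔ (adj-vertex (adj-sym (edge⇒adj e∈))))

    open Components spanning

    -- If later edges joined the ends of an edge, a simple path would do so. With no step the edge
    -- is a loop, with one step it is listed twice, and a longer path closes up with it to a cycle.
    noCycle⇒forest : NoCycle G → ∀ es → AllPairs (λ e e′ → e ≢ e′ × e ≢ swap e′) es →
                     (∀ {u v} → (u , v) ∈ es → Adj u v) → Forest es
    noCycle⇒forest noCycle [] _ _ = tt
    noCycle⇒forest noCycle ((u , v) ∷ es) (distinct ∷ distincts) sound =
      (λ joined → closes (proj₂ (star⇒simplePath (λ _ _ → em) joined))) ,
      noCycle⇒forest noCycle es distincts (sound ∘ there)
      where
      link⇒adj : ∀ {s t} → Link ((u , v) ∷ es) s t → Adj s t
      link⇒adj = Sum.[ sound , adj-sym ∘ sound ]′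

      closes : ∀ {ps} → ¬ SimplePath (Link es) u ps v
      closes done = adj-irrefl (sound (here refl))
      closes (step (inj₁ e∈) _ done) = proj₁ (All.lookup distinct e∈) refl
      closes (step (inj₂ e∈) _ done) = proj₂ (All.lookup distinct e∈) refl
      closes path@(step _ _ (step _ _ _)) = noCycle
        ( _ , _ , s≤s (s≤s (s≤s z≤n)) , simplePath⇒unique path
        , simplePath⇒linked (mapPath path) (adj-sym (sound (here refl))) )
        where
        mapPath : ∀ {s t ps} → SimplePath (Link es) s ps t → SimplePath Adj s ps t
        mapPath done           = done
        mapPath (step q s∉ qs) = step (link⇒adj (Sum.map there there q)) s∉ (mapPath qs)

  -- Connectedness makes all representatives equal, so `count` involves at most one component.
  connected⇒#vertices≤1+#edges : Connected G → length vertices ≤ suc (length edges)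
  connected⇒#vertices≤1+#edges (_ , conn) = begin
    length vertices             ≤⟨ count ⟩
    length edges + length reps  ≤⟨ +-monoʳ-≤ (length edges) (atMostOne reps-unique all-equal) ⟩
    length edges + 1            ≡⟨ +-comm (length edges) 1 ⟩
    suc (length edges)          ∎
    where
    open ≤-Reasoning
    all-equal : ∀ {r s} → r ∈ reps → s ∈ reps → r ≡ s
    all-equal r∈ s∈ = trans (sym (rep-fixed r∈))
      (trans (rep-path (Star.map adj⇒link (conn (vertex r∈) (vertex s∈)))) (rep-fixed s∈))
      where
      vertex : ∀ {t} → t ∈ reps → IsVertex t
      vertex = Equivalence.from vertex⇔ ∘ reps-⊆

    atMostOne : ∀ {xs : List Ambient} → Unique xs → (∀ {r s} → r ∈ xs → s ∈ xs → r ≡ s) → length xs ≤ 1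
    atMostOne []                   _  = z≤n
    atMostOne (_ ∷ [])             _  = s≤s z≤n
    atMostOne ((r≢s ∷ _) ∷ _ ∷ _)  eq = contradiction (eq (here refl) (there (here refl))) r≢s

  -- A forest attains equality in the component count, and the given vertex ensures at least one
  -- component.
  noCycle⇒1+#edges≤#vertices : ∃ IsVertex → NoCycle G → suc (length edges) ≤ length vertices
  noCycle⇒1+#edges≤#vertices (v , v-vertex) noCycle = begin
    suc (length edges)           ≡⟨ +-comm 1 (length edges) ⟩
    length edges + 1             ≤⟨ +-monoʳ-≤ (length edges) (nonempty (rep-∈ (Equivalence.to vertex⇔ v-vertex))) ⟩
    length edges + length reps   ≡⟨ forestCount (noCycle⇒forest noCycle edges edges-distinct edge⇒adj) ⟨
    length vertices              ∎
    where
    open ≤-Reasoning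
    nonempty : ∀ {a : Ambient} {xs} → a ∈ xs → 1 ≤ length xs
    nonempty (here _)  = s≤s z≤n
    nonempty (there _) = s≤s z≤n

-- Factors of a bi-infinite word

module _ (x : BiInfiniteWord A) where

  -- Recursion on the word replaces indexing by `Fin`, so that letters can be added or removed at
  -- either end without index arithmetic.
  OccursAt : ℤ → Word A → Set
  OccursAt i []      = ⊤
  OccursAt i (a ∷ w) = x i ≡ a × OccursAt (i ℤ.+ 1ℤ) w

  𝓛⇒occursAt : ∀ w i → ((j : Fin (length w)) → x (i ℤ.+ + toℕ j) ≡ lookup w j) → OccursAt i w
  𝓛⇒occursAt []      i eq = tt
  𝓛⇒occursAt (a ∷ w) i eq =
    trans (cong x (sym (ℤ.+-identityʳ i))) (eq zero) ,
    𝓛⇒occursAt w (i ℤ.+ 1ℤ) (λ j → trans (cong x (ℤ.+-assoc i 1ℤ (+ toℕ j))) (eq (suc j)))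

  occursAt⇒𝓛 : ∀ w i → OccursAt i w → (j : Fin (length w)) → x (i ℤ.+ + toℕ j) ≡ lookup w j
  occursAt⇒𝓛 (a ∷ w) i (eq , occ) zero    = trans (cong x (ℤ.+-identityʳ i)) eq
  occursAt⇒𝓛 (a ∷ w) i (eq , occ) (suc j) =
    trans (cong x (sym (ℤ.+-assoc i 1ℤ (+ toℕ j)))) (occursAt⇒𝓛 w (i ℤ.+ 1ℤ) occ j)

  𝓛-⇔ : ∀ {w} → 𝓛 x w ⇔ (∃[ i ] OccursAt i w)
  𝓛-⇔ {w} = mk⇔ (λ (i , eq) → i , 𝓛⇒occursAt w i eq) (λ (i , occ) → i , occursAt⇒𝓛 w i occ)

  occursAt-init : ∀ w {b i} → OccursAt i (w ∷ʳ b) → OccursAt i w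
  occursAt-init []      _          = tt
  occursAt-init (a ∷ w) (eq , occ) = eq , occursAt-init w occ

  occursAt-snoc : ∀ w {i} → OccursAt i w → ∃[ b ] OccursAt i (w ∷ʳ b)
  occursAt-snoc []      {i} _          = x i , refl , tt
  occursAt-snoc (a ∷ w) {i} (eq , occ) = let b , occ′ = occursAt-snoc w occ in b , eq , occ′

  𝓛-tail : ∀ {a w} → 𝓛 x (a ∷ w) → 𝓛 x w
  𝓛-tail aw∈ = let i , _ , occ = Equivalence.to 𝓛-⇔ aw∈ in Equivalence.from 𝓛-⇔ (_ , occ)

  𝓛-init : ∀ w {b} → 𝓛 x (w ∷ʳ b) → 𝓛 x w
  𝓛-init w wb∈ = let i , occ = Equivalence.to 𝓛-⇔ wb∈ in
    Equivalence.from 𝓛-⇔ (i , occursAt-init w occ)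

  E⁺-nonempty : ∀ w → 𝓛 x w → ∃ (E⁺ x w)
  E⁺-nonempty w w∈ = let i , occ = Equivalence.to 𝓛-⇔ w∈ ; b , occ′ = occursAt-snoc w occ in
    b , Equivalence.from 𝓛-⇔ (i , occ′)

  E⁻-nonempty : ∀ {w} → 𝓛 x w → ∃ (E⁻ x w)
  E⁻-nonempty {w} w∈ = let i , occ = Equivalence.to 𝓛-⇔ w∈ in
    x (ℤ.pred i) , Equivalence.from 𝓛-⇔ (ℤ.pred i , refl , subst (λ j → OccursAt j w) (sym (pred+1 i)) occ)
    where
    pred+1 : ∀ i → ℤ.pred i ℤ.+ 1ℤ ≡ i
    pred+1 i = trans (ℤ.+-comm (ℤ.pred i) 1ℤ) (ℤ.suc-pred i)

  -- The word `v ʳ++ w` arises from `w` by prepending the letters of `v` one after another, so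
  -- recursion on `v` follows a path of left extensions.
  𝓛-ʳ++ : ∀ v {w} → 𝓛 x (v ʳ++ w) → 𝓛 x w
  𝓛-ʳ++ []      w∈  = w∈
  𝓛-ʳ++ (a ∷ v) vw∈ = 𝓛-tail (𝓛-ʳ++ v vw∈)

  -- A cycle has at least two left vertices, so one of them would be a leaf.
  hub⇒acyclic : DecidableEquality A → ∀ {w} a →
                (∀ {c b b′} → c ≢ a → E x w (c , b) → E x w (c , b′) → b ≡ b′) → Acyclic x w
  hub⇒acyclic _≟_ {w} a leaf = λ where
      (_ , [] , s≤s () , _)
      (_ , _ ∷ [] , s≤s (s≤s ()) , _)
      -- Edges change sides, so a cycle on three vertices would have to close with an edge inside
      -- one side.
      (_ , _ ∷ _ ∷ [] , _ , _ , left-right _ _ _ ∷ right-left _ _ _ ∷ () ∷ _)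
      (_ , _ ∷ _ ∷ [] , _ , _ , right-left _ _ _ ∷ left-right _ _ _ ∷ () ∷ _)
      (inj₂ _ , inj₁ _ ∷ inj₂ _ ∷ inj₁ _ ∷ [] , _ ,
        (_ ∷ v₀≢v₂ ∷ _) ∷ (_ ∷ v₁≢v₃ ∷ _) ∷ _ , e₀ ∷ e₁ ∷ e₂ ∷ e₃ ∷ _) →
        v₁≢v₃ (hubs e₀ e₁ v₀≢v₂ e₂ e₃ (v₀≢v₂ ∘ sym))
      (inj₂ _ , inj₁ _ ∷ inj₂ _ ∷ inj₁ _ ∷ _ ∷ _ , _ ,
        (_ ∷ v₀≢v₂ ∷ _) ∷ (_ ∷ v₁≢v₃ ∷ _) ∷ (_ ∷ v₂≢v₄ ∷ _) ∷ _ , e₀ ∷ e₁ ∷ e₂ ∷ e₃ ∷ _) →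
        v₁≢v₃ (hubs e₀ e₁ v₀≢v₂ e₂ e₃ v₂≢v₄)
      (inj₁ _ , inj₂ _ ∷ inj₁ _ ∷ inj₂ _ ∷ [] , _ ,
        (_ ∷ v₀≢v₂ ∷ _) ∷ (_ ∷ v₁≢v₃ ∷ _) ∷ _ , e₀ ∷ e₁ ∷ e₂ ∷ e₃ ∷ _) →
        v₀≢v₂ (hubs e₃ e₀ (v₁≢v₃ ∘ sym) e₁ e₂ v₁≢v₃)
      (inj₁ _ , inj₂ _ ∷ inj₁ _ ∷ inj₂ _ ∷ inj₁ _ ∷ [] , _ , _ , _ ∷ _ ∷ _ ∷ _ ∷ () ∷ _)
      -- With at least six vertices, the left vertices numbered 2 and 4 have both neighbours inside
      -- the list, and the closing edge need not be inspected.
      (inj₁ _ , inj₂ _ ∷ inj₁ _ ∷ inj₂ _ ∷ inj₁ _ ∷ _ ∷ _ , _ ,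
        _ ∷ (_ ∷ v₁≢v₃ ∷ _) ∷ (_ ∷ v₂≢v₄ ∷ _) ∷ (_ ∷ v₃≢v₅ ∷ _) ∷ _ ,
        _ ∷ e₁ ∷ e₂ ∷ e₃ ∷ e₄ ∷ _) →
        v₂≢v₄ (hubs e₁ e₂ v₁≢v₃ e₃ e₄ v₃≢v₅)
    where
    isHub : ∀ {c p q} → ExtensionEdge x w p (inj₁ c) → ExtensionEdge x w (inj₁ c) q → p ≢ q → c ≡ a
    isHub {c} (right-left _ _ e) (left-right _ _ e′) p≢q =
      decidable-stable (c ≟ a) λ c≢a → p≢q (cong inj₂ (leaf c≢a e e′))

    hubs : ∀ {c d p q r s} →
           ExtensionEdge x w p (inj₁ c) → ExtensionEdge x w (inj₁ c) q → p ≢ q →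
           ExtensionEdge x w r (inj₁ d) → ExtensionEdge x w (inj₁ d) s → r ≢ s →
           _≡_ {A = A ⊎ A} (inj₁ c) (inj₁ d)
    hubs e e′ p≢q f f′ r≢s = cong inj₁ (trans (isHub e e′ p≢q) (sym (isHub f f′ r≢s)))

-- Multiplicities and edge counts of extension graphs

module _ (em : ExcludedMiddle 0ℓ) (𝒜 : Alphabet) (x : BiInfiniteWord (Letter 𝒜)) where

  ∈-letters : ∀ a → a ∈ letters 𝒜
  ∈-letters a = subst (_∈ letters 𝒜) (Inverse.strictlyInverseˡ enumeration a) (∈-map⁺ _ (∈-allFin _))
    where open Alphabet 𝒜 using (size; enumeration)

  letters-unique : Unique (letters 𝒜)
  letters-unique = Unique.map⁺ injective (Unique.allFin⁺ size)
    where
    open Alphabet 𝒜 using (size; enumeration)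
    injective : ∀ {i j} → Inverse.to enumeration i ≡ Inverse.to enumeration j → i ≡ j
    injective {i} {j} eq = begin
      i   ≡⟨ Inverse.strictlyInverseʳ enumeration i ⟨
      _   ≡⟨ cong (Inverse.from enumeration) eq ⟩
      _   ≡⟨ Inverse.strictlyInverseʳ enumeration j ⟩
      j   ∎
      where open ≡-Reasoning

  private
    𝔸 = Letter 𝒜
    #e  = #E em 𝒜 x
    #e⁻ = #E⁻ em 𝒜 x
    #e⁺ = #E⁺ em 𝒜 x

  -- Gathering the subtracted terms turns the sign of the multiplicity into a comparison of natural
  -- numbers.
  multiplicity-≡ : ∀ w → multiplicity em 𝒜 x w ≡ + suc (#e w) ℤ.- + (#e⁻ w + #e⁺ w)
  multiplicity-≡ w = rearrange (+ #e w) (+ #e⁻ w) (+ #e⁺ w)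
    where
    rearrange : ∀ i j k → i ℤ.- j ℤ.- k ℤ.+ 1ℤ ≡ (1ℤ ℤ.+ i) ℤ.- (j ℤ.+ k)
    rearrange = solve-∀

  neutral⇐ : ∀ {w} → suc (#e w) ≡ #e⁻ w + #e⁺ w → Neutral em 𝒜 x w
  neutral⇐ {w} eq = trans (multiplicity-≡ w) (ℤ.i≡j⇒i-j≡0 (cong +_ eq))

  weakOrNeutral⇔ : ∀ {w} → WeakOrNeutral em 𝒜 x w ⇔ suc (#e w) ≤ #e⁻ w + #e⁺ w
  weakOrNeutral⇔ {w} = mk⇔ to from
    where
    to : WeakOrNeutral em 𝒜 x w → suc (#e w) ≤ #e⁻ w + #e⁺ w
    to won = ℤ.drop‿+≤+ (ℤ.i-j≤0⇒i≤j (subst (ℤ._≤ 0ℤ) (multiplicity-≡ w) (Sum.[ ℤ.<⇒≤ , ℤ.≤-reflexive ]′ won)))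

    from : suc (#e w) ≤ #e⁻ w + #e⁺ w → WeakOrNeutral em 𝒜 x w
    from le with em {Neutral em 𝒜 x w}
    ... | yes neutral = inj₂ neutral
    ... | no ¬neutral = inj₁ (ℤ.≤∧≢⇒<
      (subst (ℤ._≤ 0ℤ) (sym (multiplicity-≡ w)) (ℤ.i≤j⇒i-j≤0 (ℤ.+≤+ le))) ¬neutral)

  extensionGraph-finite : ∀ w → FiniteGraph (extensionGraph x w)
  extensionGraph-finite w = record
    { vertices        = lefts ++ rights
    ; vertices-unique = Unique.++⁺
        (Unique.map⁺ inj₁-injective (Unique.filter⁺ _ letters-unique))
        (Unique.map⁺ inj₂-injective (Unique.filter⁺ _ letters-unique))
        disjoint
    ; vertex⇔         = mk⇔ vertex-to (Sum.[ left-from , right-from ]′ ∘ ∈-++⁻ lefts)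
    ; edges           = edges
    -- All listed pairs point from left to right, so none is the swap of another.
    ; edges-distinct  = AllPairs.map⁺ (AllPairs.map (λ ne → (λ { refl → ne refl }) , λ ())
        (Unique.filter⁺ _ (Unique.cartesianProduct⁺ letters-unique letters-unique)))
    ; edge⇒adj        = edge-adj
    ; adj⇒link        = λ { (left-right _ _ e) → inj₁ (edge-∈ e)
                          ; (right-left _ _ e) → inj₂ (edge-∈ e) }
    }
    where
    lefts rights : List (𝔸 ⊎ 𝔸)
    lefts  = map inj₁ (filter (λ a → em {E⁻ x w a}) (letters 𝒜))
    rights = map inj₂ (filter (λ b → em {E⁺ x w b}) (letters 𝒜))

    edge : 𝔸 × 𝔸 → (𝔸 ⊎ 𝔸) × (𝔸 ⊎ 𝔸)
    edge (a , b) = inj₁ a , inj₂ b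

    edges : List ((𝔸 ⊎ 𝔸) × (𝔸 ⊎ 𝔸))
    edges = map edge (filter (λ ab → em {E x w ab}) (cartesianProduct (letters 𝒜) (letters 𝒜)))

    disjoint : ∀ {v} → ¬ (v ∈ lefts × v ∈ rights)
    disjoint (l∈ , r∈) with ∈-map⁻ inj₁ l∈ | ∈-map⁻ inj₂ r∈
    ... | _ , _ , refl | _ , _ , ()

    vertex-to : ∀ {v} → ExtensionVertex x w v → v ∈ lefts ++ rights
    vertex-to (left a∈)  = ∈-++⁺ˡ (∈-map⁺ inj₁ (∈-filter⁺ _ (∈-letters _) a∈))
    vertex-to (right b∈) = ∈-++⁺ʳ lefts (∈-map⁺ inj₂ (∈-filter⁺ _ (∈-letters _) b∈))

    left-from : ∀ {v} → v ∈ lefts → ExtensionVertex x w v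
    left-from v∈ with ∈-map⁻ inj₁ v∈
    ... | a , a∈ , refl = left (proj₂ (∈-filter⁻ (λ a → em {E⁻ x w a}) {xs = letters 𝒜} a∈))

    right-from : ∀ {v} → v ∈ rights → ExtensionVertex x w v
    right-from v∈ with ∈-map⁻ inj₂ v∈
    ... | b , b∈ , refl = right (proj₂ (∈-filter⁻ (λ b → em {E⁺ x w b}) {xs = letters 𝒜} b∈))

    edge-∈ : ∀ {a b} → E x w (a , b) → edge (a , b) ∈ edges
    edge-∈ e = ∈-map⁺ edge (∈-filter⁺ _ (∈-cartesianProduct⁺ (∈-letters _) (∈-letters _)) e)

    edge-adj : ∀ {u v} → (u , v) ∈ edges → ExtensionEdge x w u v
    edge-adj uv∈ with ∈-map⁻ edge uv∈
    ... | (a , b) , ab∈ , refl = left-right (𝓛-init x (a ∷ w) e) (𝓛-tail x e) e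
      where
      e : E x w (a , b)
      e = proj₂ (∈-filter⁻ (λ ab → em {E x w ab}) {xs = cartesianProduct (letters 𝒜) (letters 𝒜)} ab∈)

  module _ (w : Word 𝔸) where
    open FiniteGraph (extensionGraph-finite w)

    #vertices : length vertices ≡ #e⁻ w + #e⁺ w
    #vertices = trans (length-++ (map inj₁ (filter (λ a → em {E⁻ x w a}) (letters 𝒜))))
      (cong₂ _+_ (length-map inj₁ (filter (λ a → em {E⁻ x w a}) (letters 𝒜)))
                 (length-map inj₂ (filter (λ b → em {E⁺ x w b}) (letters 𝒜))))

    #edges : length edges ≡ #e w
    #edges = length-map _ (filter (λ ab → em {E x w ab}) (cartesianProduct (letters 𝒜) (letters 𝒜)))

  -- A nonempty forest has fewer edges than vertices; a left extension of `w` supplies a vertex.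
  acyclic⇒1+#E≤ : ∀ {w} → 𝓛 x w → Acyclic x w → suc (#e w) ≤ #e⁻ w + #e⁺ w
  acyclic⇒1+#E≤ {w} w∈ acyclic = subst₂ _≤_ (cong suc (#edges w)) (#vertices w)
    (noCycle⇒1+#edges≤#vertices em (extensionGraph-finite w)
      (let a , a∈ = E⁻-nonempty x w∈ in inj₁ a , left a∈) acyclic)

  acyclic⇒weakOrNeutral : ∀ {w} → 𝓛 x w → Acyclic x w → WeakOrNeutral em 𝒜 x w
  acyclic⇒weakOrNeutral w∈ acyclic = Equivalence.from weakOrNeutral⇔ (acyclic⇒1+#E≤ w∈ acyclic)

  -- A tree has exactly one vertex more than it has edges: acyclicity gives one inequality and
  -- connectedness the other.
  dendric⇒neutral : ∀ {w} → 𝓛 x w → Dendric x w → Neutral em 𝒜 x w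
  dendric⇒neutral {w} w∈ (connected , acyclic) = neutral⇐ (≤-antisym (acyclic⇒1+#E≤ w∈ acyclic)
    (subst₂ _≤_ (#vertices w) (cong suc (#edges w))
      (connected⇒#vertices≤1+#edges em (extensionGraph-finite w) connected)))

  -- Excess of right extensions

  excess : Word 𝔸 → ℕ
  -- Outside the language `#E⁺` is 0 and truncation keeps the excess at 0, so sums over all letters
  -- receive contributions from left extensions only.
  excess w = pred (#e⁺ w)

  #E⁺-positive : ∀ w → 𝓛 x w → 0 < #e⁺ w
  #E⁺-positive w w∈ = let b , b∈ = E⁺-nonempty x w w∈ in
    filter-some (λ b → em) (lose (∈-letters b) b∈)

  #E⁺≡1+excess : ∀ w → 𝓛 x w → #e⁺ w ≡ suc (excess w)
  #E⁺≡1+excess w w∈ = sym (suc-pred (#e⁺ w) {{>-nonZero (#E⁺-positive w w∈)}})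

  #E⁺≡0 : ∀ w → ¬ 𝓛 x w → #e⁺ w ≡ 0
  #E⁺≡0 w w∉ = cong length (filter-none (λ b → em) {xs = letters 𝒜} (All.tabulate λ _ wb∈ → w∉ (𝓛-init x w wb∈)))

  excess-∷-≤ : ∀ a w → excess (a ∷ w) ≤ excess w
  excess-∷-≤ a w = pred-mono-≤ (length-filter-mono (λ b → em) (λ b → em) (𝓛-tail x) (letters 𝒜))

  excess-ʳ++-≤ : ∀ v w → excess (v ʳ++ w) ≤ excess w
  excess-ʳ++-≤ []      w = ≤-refl
  excess-ʳ++-≤ (a ∷ v) w = ≤-trans (excess-ʳ++-≤ v (a ∷ w)) (excess-∷-≤ a w)

  -- Counting pairs by their left letter writes `#E w` as the sum of `#E⁺ (a ∷ w)`, which is `#E⁻ w`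
  -- plus the sum of the excesses. Then `#E⁻ w` and a one cancel from the weak-or-neutral
  -- inequality.
  excess-sum-≤ : ∀ {w} → 𝓛 x w → WeakOrNeutral em 𝒜 x w →
                 sum (map (λ a → excess (a ∷ w)) (letters 𝒜)) ≤ excess w
  excess-sum-≤ {w} w∈ won = s≤s⁻¹ (+-cancelˡ-≤ (#e⁻ w) _ _ (begin
    #e⁻ w + suc s          ≡⟨ +-suc (#e⁻ w) s ⟩
    suc (#e⁻ w + s)        ≡⟨ cong suc #E≡ ⟨
    suc (#e w)             ≤⟨ Equivalence.to weakOrNeutral⇔ won ⟩
    #e⁻ w + #e⁺ w          ≡⟨ cong (_+_ (#e⁻ w)) (#E⁺≡1+excess w w∈) ⟩
    #e⁻ w + suc (excess w) ∎))
    where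
    open ≤-Reasoning
    s = sum (map (λ a → excess (a ∷ w)) (letters 𝒜))
    #E≡ : #e w ≡ #e⁻ w + s
    #E≡ = trans (length-filter-cartesianProduct (λ ab → em) (letters 𝒜) (letters 𝒜))
      (sum-pred (λ a → em) (λ a → #e⁺ (a ∷ w)) (λ a → #E⁺-positive (a ∷ w)) (λ a → #E⁺≡0 (a ∷ w)) (letters 𝒜))

  excess-split : ∀ {w a c} → 𝓛 x w → WeakOrNeutral em 𝒜 x w → a ≢ c →
                 excess (a ∷ w) + excess (c ∷ w) ≤ excess w
  excess-split {w} w∈ won a≢c = ≤-trans
    (∈-≢⇒+≤sum (λ a → excess (a ∷ w)) (∈-letters _) (∈-letters _) a≢c) (excess-sum-≤ w∈ won)

  ExcessPreserving : Word 𝔸 → Set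
  ExcessPreserving w = ∃[ a ] E⁻ x w a × excess (a ∷ w) ≡ excess w

  preserving⇒dendric : ∀ {w} → 𝓛 x w → WeakOrNeutral em 𝒜 x w → ExcessPreserving w → Dendric x w
  preserving⇒dendric {w} w∈ won (a , aw∈ , eq) =
    ((inj₁ a , left aw∈) , λ u v → Star.reverse adj-sym (fromHub u) ◅◅ fromHub v) ,
    hub⇒acyclic x (λ _ _ → em) a leaf
    where
    open Graph (extensionGraph x w) using (adj-sym)

    full : ∀ {b} → E⁺ x w b → E x w (a , b)
    full b∈ = length-filter-≡⇒⊇ (λ b → em) (λ b → em) (𝓛-tail x)
      (trans (#E⁺≡1+excess (a ∷ w) aw∈) (trans (cong suc eq) (sym (#E⁺≡1+excess w w∈)))) (∈-letters _) b∈

    fromHub : ∀ {v} → ExtensionVertex x w v → Star (ExtensionEdge x w) (inj₁ a) v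
    fromHub (right b∈) = left-right aw∈ b∈ (full b∈) ◅ ε
    -- Any right extension of `c ∷ w` is a common neighbour of `c` and the hub.
    fromHub (left c∈)  = let b , cwb∈ = E⁺-nonempty x (_ ∷ w) c∈ ; b∈ = 𝓛-tail x cwb∈ in
      left-right aw∈ b∈ (full b∈) ◅ right-left c∈ b∈ cwb∈ ◅ ε

    leaf : ∀ {c b b′} → c ≢ a → E x w (c , b) → E x w (c , b′) → b ≡ b′
    leaf {c} c≢a cwb∈ cwb′∈ = length≤1⇒≡ one
      (∈-filter⁺ (λ b → em) (∈-letters _) cwb∈) (∈-filter⁺ (λ b → em) (∈-letters _) cwb′∈)
      where
      one : #e⁺ (c ∷ w) ≤ 1
      one = begin
        #e⁺ (c ∷ w)           ≡⟨ #E⁺≡1+excess (c ∷ w) (𝓛-init x (c ∷ w) cwb∈) ⟩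
        -- The hub `a` already takes up all of `excess w`, which leaves 0 for `c`.
        suc (excess (c ∷ w))  ≤⟨ s≤s (+-cancelʳ-≤ (excess w) _ 0
          (subst (λ k → excess (c ∷ w) + k ≤ excess w) eq (excess-split w∈ won c≢a))) ⟩
        1                     ∎
        where open ≤-Reasoning

  -- Excess preservation in all long left extensions

  EventuallyPreserving : Word 𝔸 → Set
  -- One bound has to serve all left extensions of `w`. The first letter of `v` is the one next to
  -- `w`, so the tree of extensions is explored by recursion on `v`.
  EventuallyPreserving w = ∃[ n ] ∀ v → 𝓛 x (v ʳ++ w) → n ≤ length v → ExcessPreserving (v ʳ++ w)

  -- Finiteness of the alphabet enters here: the sum of the bounds of all children dominates each of
  -- them, and the successor accounts for the letter `a`.
  eventuallyPreserving-∷ : ∀ {w} → (∀ a → EventuallyPreserving (a ∷ w)) → EventuallyPreserving w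
  eventuallyPreserving-∷ {w} ev = suc bound , λ where
      (a ∷ v) vaw∈ (s≤s le) → proj₂ (ev a) v vaw∈ (≤-trans (∈⇒≤sum (proj₁ ∘ ev) (∈-letters a)) le)
    where bound = sum (map (proj₁ ∘ ev) (letters 𝒜))

  ∉⇒eventuallyPreserving : ∀ {w} → ¬ 𝓛 x w → EventuallyPreserving w
  ∉⇒eventuallyPreserving w∉ = 0 , λ v vw∈ _ → contradiction (𝓛-ʳ++ x v vw∈) w∉

  -- Excess cannot grow under left extension, so a word of excess 0 is preserved by any of its left
  -- extensions.
  nonPreserving⇒0<excess : ∀ {w} → 𝓛 x w → ¬ ExcessPreserving w → 0 < excess w
  nonPreserving⇒0<excess {w} w∈ ¬pres = n≢0⇒n>0 λ e≡0 → let a , a∈ = E⁻-nonempty x w∈ in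
    ¬pres (a , a∈ , trans (n≤0⇒n≡0 (subst (excess (a ∷ w) ≤_) e≡0 (excess-∷-≤ a w))) (sym e≡0))

  module _ {K : ℕ} (K-from : From x (WeakOrNeutral em 𝒜 x) K) where

    -- Strong induction on the excess. Either the bound 0 serves, or some `v ʳ++ w` is not
    -- preserving. In the latter case `descend` follows the path to it, and the induction hypothesis
    -- covers every branch off that path and every left extension of its end within the language.
    long⇒eventuallyPreserving : ∀ k w → excess w ≡ k → K ≤ length w → EventuallyPreserving w
    long⇒eventuallyPreserving = <-rec _ induct
      where
      induct : ∀ k → (∀ {j} → j < k → ∀ w → excess w ≡ j → K ≤ length w → EventuallyPreserving w) →
               ∀ w → excess w ≡ k → K ≤ length w → EventuallyPreserving w
      induct k smaller w refl K≤ = decidable-stable em λ ¬ev → ¬ev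
        (0 , λ v vw∈ _ → decidable-stable em λ ¬pres → ¬ev (descend v w ≤-refl K≤ vw∈ ¬pres))
        where
        -- A non-preserving v ʳ++ u has positive excess, which is missing from the
        -- excess of every branch leaving the path from u to it.
        descend : ∀ v u → excess u ≤ k → K ≤ length u →
                  𝓛 x (v ʳ++ u) → ¬ ExcessPreserving (v ʳ++ u) → EventuallyPreserving u
        descend [] u u≤k K≤ u∈ ¬pres = eventuallyPreserving-∷ child
          where
          child : ∀ a → EventuallyPreserving (a ∷ u)
          child a with em {𝓛 x (a ∷ u)}
          ... | no au∉  = ∉⇒eventuallyPreserving au∉
          -- Here `u` itself is not preserving, so its left extension by `a` has strictly smaller
          -- excess.
          ... | yes au∈ = smaller
            (<-≤-trans (≤∧≢⇒< (excess-∷-≤ a u) (λ eq → ¬pres (a , au∈ , eq))) u≤k) _ refl (m≤n⇒m≤1+n K≤)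
        descend (a ∷ v) u u≤k K≤ vau∈ ¬pres = eventuallyPreserving-∷ child
          where
          au∈ = 𝓛-ʳ++ x v vau∈
          u∈  = 𝓛-tail x au∈

          0<a : 0 < excess (a ∷ u)
          0<a = <-≤-trans (nonPreserving⇒0<excess vau∈ ¬pres) (excess-ʳ++-≤ v (a ∷ u))

          child : ∀ c → EventuallyPreserving (c ∷ u)
          child c with em {c ≡ a}
          ... | yes refl = descend v (a ∷ u) (≤-trans (excess-∷-≤ a u) u≤k) (m≤n⇒m≤1+n K≤) vau∈ ¬pres
          ... | no c≢a   = smaller
            (<-≤-trans (m<m+n _ 0<a) (≤-trans (excess-split u∈ (K-from u u∈ K≤) c≢a) u≤k)) _ refl (m≤n⇒m≤1+n K≤)

    -- Words shorter than `K` are reduced to long ones by `m` left extensions, with bounds collected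
    -- over the alphabet at each stage.
    eventuallyPreserving : ∀ m w → K ≤ m + length w → EventuallyPreserving w
    eventuallyPreserving zero    w K≤ = long⇒eventuallyPreserving _ w refl K≤
    eventuallyPreserving (suc m) w K≤ = eventuallyPreserving-∷ λ a →
      eventuallyPreserving m (a ∷ w) (≤-trans K≤ (≤-reflexive (sym (+-suc m (length w)))))

    eventuallyDendric : Eventually x (Dendric x)
    eventuallyDendric = let n , pres = eventuallyPreserving K [] (m≤m+n K 0) in
      -- Every word is a left extension of `[]` along its own reversal. Length `K` makes it weak or
      -- neutral, and length `n` makes it preserving.
      K + n , λ w w∈ le → preserving⇒dendric w∈ (K-from w w∈ (m+n≤o⇒m≤o K le))
        (subst ExcessPreserving (reverse-involutive w)
          (pres (reverse w) (subst (𝓛 x) (sym (reverse-involutive w)) w∈)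
            (subst (n ≤_) (sym (length-reverse w)) (m+n≤o⇒n≤o K le))))

-- Thresholds and the equivalences

module _ (x : BiInfiniteWord A) {P Q : Pred (Word A) 0ℓ} where

  from-map : (∀ {w} → 𝓛 x w → P w → Q w) → ∀ {n} → From x P n → From x Q n
  from-map P⇒Q from w w∈ le = P⇒Q w∈ (from w w∈ le)

  eventually-map : (∀ {w} → 𝓛 x w → P w → Q w) → Eventually x P → Eventually x Q
  eventually-map P⇒Q (n , from) = n , from-map P⇒Q from

  -- The threshold of the stronger property is also a bound for the weaker one, whose threshold is
  -- the least such bound.
  threshold-mono : (∀ {w} → 𝓛 x w → P w → Q w) → ∀ {m n} →
                   IsThreshold x Q m → IsThreshold x P n → m ≤ n
  threshold-mono P⇒Q (_ , least) (from , _) = least _ (from-map P⇒Q from)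

-- Descent from any bound: excluded middle decides whether a smaller bound exists, and
-- well-foundedness stops the search.
threshold : ExcludedMiddle 0ℓ → (x : BiInfiniteWord A) {P : Pred (Word A) 0ℓ} →
            Eventually x P → ∃ (IsThreshold x P)
threshold em x {P} (n , n-from) = <-rec (λ n → From x P n → ∃ (IsThreshold x P)) least n n-from
  where
  least : ∀ n → (∀ {m} → m < n → From x P m → ∃ (IsThreshold x P)) → From x P n → ∃ (IsThreshold x P)
  least n smaller n-from with em {∃[ m ] m < n × From x P m}
  ... | yes (m , m<n , m-from) = smaller m<n m-from
  ... | no none = n , n-from , λ m m-from → ≮⇒≥ λ m<n → none (m , m<n , m-from)

proposition4 : (em : ExcludedMiddle 0ℓ) (𝒜 : Alphabet) (x : BiInfiniteWord (Letter 𝒜)) →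
    (Eventually x (Dendric x) ⇔ Eventually x (Acyclic x)) ×
    (Eventually x (Dendric x) ⇔ Eventually x (Neutral em 𝒜 x)) ×
    (Eventually x (Dendric x) ⇔ Eventually x (WeakOrNeutral em 𝒜 x)) ×
    (Eventually x (Dendric x) →
    ∃[ N ] ∃[ M ] ∃[ M′ ] ∃[ K ]
    IsThreshold x (Dendric x) N × IsThreshold x (Acyclic x) M ×
    IsThreshold x (Neutral em 𝒜 x) M′ × IsThreshold x (WeakOrNeutral em 𝒜 x) K ×
    (K ≤ M) × (M ≤ N) × (K ≤ M′) × (M′ ≤ N))
proposition4 em 𝒜 x =
  -- For a single word of the language, dendric is the strongest of the four properties and
  -- weak-or-neutral the weakest. Only the return `won⇒d` has to pass to longer words.
  mk⇔ (eventually-map x d⇒a) (won⇒d ∘ eventually-map x a⇒won) ,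
  mk⇔ (eventually-map x d⇒n) (won⇒d ∘ eventually-map x n⇒won) ,
  mk⇔ (eventually-map x d⇒won) won⇒d ,
  λ d → let
      N  , isN  = threshold em x d
      M  , isM  = threshold em x (eventually-map x d⇒a d)
      M′ , isM′ = threshold em x (eventually-map x d⇒n d)
      K  , isK  = threshold em x (eventually-map x d⇒won d)
    in N , M , M′ , K , isN , isM , isM′ , isK ,
       threshold-mono x a⇒won isK isM , threshold-mono x d⇒a isM isN ,
       threshold-mono x n⇒won isK isM′ , threshold-mono x d⇒n isM′ isN
  where
  d⇒a : ∀ {w} → 𝓛 x w → Dendric x w → Acyclic x w
  d⇒a _ = proj₂

  d⇒n : ∀ {w} → 𝓛 x w → Dendric x w → Neutral em 𝒜 x w
  d⇒n = dendric⇒neutral em 𝒜 x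

  a⇒won : ∀ {w} → 𝓛 x w → Acyclic x w → WeakOrNeutral em 𝒜 x w
  a⇒won = acyclic⇒weakOrNeutral em 𝒜 x

  n⇒won : ∀ {w} → 𝓛 x w → Neutral em 𝒜 x w → WeakOrNeutral em 𝒜 x w
  n⇒won _ = inj₂

  d⇒won : ∀ {w} → 𝓛 x w → Dendric x w → WeakOrNeutral em 𝒜 x w
  d⇒won w∈ d = n⇒won w∈ (d⇒n w∈ d)

  won⇒d : Eventually x (WeakOrNeutral em 𝒜 x) → Eventually x (Dendric x)
  won⇒d (K , from) = eventuallyDendric em 𝒜 x from
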